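{- Let $q$ be a prime power and $n,t,m$ positive integers with $t\geq m$. Let $\ell$ be a positive integer such that $$ {\ell+s\choose t}\left(\frac{m}{q}\right)^{n}<s+1 $$ for some integer $s\geq 0$. Then $EGZ(t,\mathbb{F}_q^{n},m) > \ell$.
   Context: $\mathbb{F}_q^n$ is viewed as a commutative ring with coordinatewise operations. For elements $g_1,\dots,g_t$ of a commutative ring $R$, $e_m(g_1,\dots,g_t)=\sum_{1\leq i_1<\cdots<i_m\leq t}\prod_{j=1}^m g_{i_j}$. A sequence over $R$ is a finite list of elements of $R$ (repetitions allowed); a subsequence of length $t$ is obtained by choosing $t$ distinct positions. For a finite commutative ring $R$, $EGZ(t,R,m)$ is the smallest positive integer $\ell$ such that every sequence $S$ over $R$ of length $|S|\geq \ell$ contains a subsequence $S'$ of length $t$ with $e_m(S')=0$ in $R$; if no such $\ell$ exists, $EGZ(t,R,m)=\infty$. -}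

module Defs where

open import Algebra.Bundles using (CommutativeRing)
import Algebra.Construct.Pointwise as Pointwise
import Algebra.Definitions.RawSemiring as RawSemiringDefinitions
open import Data.Empty using (⊥-elim)
open import Data.Fin.Base using (Fin; zero; suc; combine; finToFun; funToFin)
open import Data.Fin.Properties using (all?; any?; finToFun-funToFin; funToFin-finToFin) renaming (_≟_ to _≟ᶠ_)
open import Data.List.Base using (List; []; _∷_; _++_; map; foldr; length; replicate; take; filter; tabulate)
open import Data.List.Properties using (length-replicate; length-tabulate; length-take)
open import Data.List.Relation.Binary.Pointwise using ([]; _∷_)
open import Data.List.Relation.Unary.All using (All; []; _∷_; universal)
open import Data.List.Relation.Unary.Any using (Any; here; there)
open import Data.List.Relation.Unary.Any.Properties using (tabulate⁺)
import Data.List.Relation.Binary.Equality.Setoid as ListEquality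
import Data.List.Relation.Binary.Sublist.DecSetoid as DecSublist
import Data.List.Relation.Binary.Sublist.Setoid as Sublist
import Data.List.Relation.Binary.Sublist.Setoid.Properties as SublistProperties
open import Data.Nat.Base using (ℕ; zero; suc; _+_; _*_; _≤_; _<_; z≤n; s≤s; _≥_)
  renaming (_^_ to _^ℕ_)
open import Data.Nat.Primality using (Prime)
import Data.Nat.Properties as ℕ
import Data.Rational.Base as ℚ
open import Data.Product.Base using (∃; ∃₂; _×_; _,_; proj₁; proj₂; map₂)
open import Data.Sum.Base using (_⊎_; inj₁; inj₂)
open import Function.Base using (_∘_)
open import Function.Bundles using (Inverse)
open import Level using (Level; _⊔_)
open import Relation.Binary.Bundles using (DecSetoid)
open import Relation.Binary.PropositionalEquality as ≡ using (_≡_; refl; cong; cong₂)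
open import Relation.Nullary.Construct.Add.Supremum using (_⁺; [_]; ⊤⁺)
open import Relation.Nullary.Decidable using (Dec; yes; no; map′; _×-dec_; _→-dec_)
open import Relation.Nullary.Negation using (¬_; contradiction)
import Relation.Binary.Construct.Add.Supremum.Strict as Strict
import Relation.Binary.Reasoning.Setoid as SetoidReasoning

open Strict _<_ using (_<⁺_) public

private
  variable
    a c ℓ p : Level
    A : Set a

open RawSemiringDefinitions ℚ.+-*-rawSemiring using () renaming (_^_ to _^ℚ_) public

IsPrimePower : ℕ → Set
IsPrimePower q = ∃₂ λ p k → Prime p × 1 ≤ k × q ≡ p ^ℕ k

HasSize : CommutativeRing c ℓ → ℕ → Set (c ⊔ ℓ)
HasSize R N = Inverse (CommutativeRing.setoid R) (≡.setoid (Fin N))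

Finite : CommutativeRing c ℓ → Set (c ⊔ ℓ)
Finite R = ∃ (HasSize R)

IsField : CommutativeRing c ℓ → Set (c ⊔ ℓ)
IsField R = ¬ (1# ≈ 0#) × (∀ x → ¬ (x ≈ 0#) → ∃ λ y → x ∙ y ≈ 1#)
  where open CommutativeRing R renaming (_*_ to _∙_)

record FiniteField (c ℓ : Level) (q : ℕ) : Set (Level.suc (c ⊔ ℓ)) where
  field
    commutativeRing : CommutativeRing c ℓ
    isField         : IsField commutativeRing
    hasSize         : HasSize commutativeRing q

Power : CommutativeRing c ℓ → ℕ → CommutativeRing c ℓ
Power R n = Pointwise.commutativeRing (Fin n) R

Power-finite : (R : CommutativeRing c ℓ) → Finite R → ∀ n → Finite (Power R n)
Power-finite R (N , size) n = N ^ℕ n , record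
  { to        = λ f → funToFin (to ∘ f)
  ; from      = λ i → from ∘ finToFun {N} {n} i
  ; to-cong   = λ f≈g → funToFin-cong (λ i → to-cong (f≈g i))
  ; from-cong = λ { refl _ → R.refl }
  ; inverse   =
      (λ {i} f≈ → ≡.trans (funToFin-cong (λ j → inverseˡ (f≈ j)))
                          (funToFin-finToFin {n} {N} i))
    , (λ { {f} refl j → R.trans (from-cong (finToFun-funToFin (to ∘ f) j))
                                (strictlyInverseʳ (f j)) })
  }
  where
  module R = CommutativeRing R
  open Inverse size

  funToFin-cong : ∀ {k} {f g : Fin k → Fin N} → (∀ i → f i ≡ g i) →
                  funToFin f ≡ funToFin g
  funToFin-cong {zero}  f≡g = refl
  funToFin-cong {suc k} f≡g = cong₂ combine (f≡g zero) (funToFin-cong (f≡g ∘ suc))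

-- The choices of m positions i₁ < ⋯ < iₘ in a list, each given by the entries
-- at those positions; choices with equal entries are listed separately.
combinations : ℕ → List A → List (List A)
combinations zero    xs       = [] ∷ []
combinations (suc m) []       = []
combinations (suc m) (x ∷ xs) =
  map (x ∷_) (combinations m xs) ++ combinations (suc m) xs

module _ (R : CommutativeRing c ℓ) where

  open CommutativeRing R using (Carrier; _≈_; 0#; 1#; setoid)
    renaming (_+_ to _⊕_; _*_ to _⊗_)
  open Sublist setoid using (_⊆_)

  esym : ℕ → List Carrier → Carrier
  esym m gs = foldr _⊕_ 0# (map (foldr _⊗_ 1#) (combinations m gs))

  -- S′ ⊆ S selects entries of S at distinct positions, in order.  Since eₘ is
  -- symmetric, the order in which positions are chosen is immaterial.
  HasZeroSubsequence : (t m : ℕ) → List Carrier → Set (c ⊔ ℓ)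
  HasZeroSubsequence t m S = ∃ λ S′ → S′ ⊆ S × length S′ ≡ t × esym m S′ ≈ 0#

  Forces : (t m k : ℕ) → Set (c ⊔ ℓ)
  Forces t m k = ∀ S → length S ≥ k → HasZeroSubsequence t m S

  -- ⊤⁺ is ∞.
  IsEGZ : (t m : ℕ) → ℕ ⁺ → Set (c ⊔ ℓ)
  IsEGZ t m [ k ] = 1 ≤ k × Forces t m k × (∀ j → 1 ≤ j → Forces t m j → k ≤ j)
  IsEGZ t m ⊤⁺    = ∀ j → 1 ≤ j → ¬ Forces t m j

-- The remaining lemmas show that the constant exists for every finite R, so
-- that it can be defined as a value.  Whether k forces a zero subsequence is
-- decidable since only the finitely many sequences of length k matter.  If the
-- all-ones sequence of length t has eₘ = 0 then every constant sequence has,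
-- and t |R| + 1 forces one by the pigeonhole principle; otherwise long all-ones
-- sequences show that no k does.

private
  least-or-none : {P : ℕ → Set p} → (∀ k → Dec (P k)) → ∀ n →
    (∃ λ k → 1 ≤ k × P k × (∀ j → 1 ≤ j → P j → k ≤ j)) ⊎
    (∀ j → 1 ≤ j → j ≤ n → ¬ P j)
  least-or-none P? zero = inj₂ λ { _ () z≤n }
  least-or-none {P = P} P? (suc n) with least-or-none P? n
  ... | inj₁ found = inj₁ found
  ... | inj₂ none  with P? (suc n)
  ...   | yes q = inj₁ (suc n , s≤s z≤n , q , λ j 1≤j Pj →
                    ℕ.≰⇒> λ j≤n → none j 1≤j j≤n Pj)
  ...   | no ¬q = inj₂ upTo
    where
    upTo : ∀ j → 1 ≤ j → j ≤ suc n → ¬ P j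
    upTo j 1≤j j≤1+n Pj with ℕ.m≤n⇒m<n∨m≡n j≤1+n
    ... | inj₁ (s≤s j≤n) = none j 1≤j j≤n Pj
    ... | inj₂ refl      = ¬q Pj

module _ (R : CommutativeRing c ℓ) where

  private
    module R = CommutativeRing R
    open R using (Carrier; _≈_; 0#; 1#; setoid) renaming (_+_ to _⊕_; _*_ to _⊗_)
    open Sublist setoid using (_⊆_; []; _∷_; _∷ʳ_; ⊆-refl; ⊆-trans; ⊆-reflexive)
    open ListEquality setoid using (_≋_; ≋-refl; ≋-length)
    open SublistProperties setoid using (take-⊆; filter-⊆)

    esym-∷ : ∀ m x xs → esym R (suc m) (x ∷ xs) ≈ (x ⊗ esym R m xs) ⊕ esym R (suc m) xs
    esym-∷ m x xs = go (combinations m xs)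
      where
      rest = combinations (suc m) xs
      sumOfProducts = λ (css : List (List Carrier)) → foldr _⊕_ 0# (map (foldr _⊗_ 1#) css)

      go : ∀ css → sumOfProducts (map (x ∷_) css ++ rest) ≈
                   (x ⊗ sumOfProducts css) ⊕ sumOfProducts rest
      go [] = R.sym (R.trans (R.+-congʳ (R.zeroʳ x)) (R.+-identityˡ _))
      go (cs ∷ css) = R.trans (R.+-congˡ (go css))
        (R.trans (R.sym (R.+-assoc _ _ _)) (R.+-congʳ (R.sym (R.distribˡ x _ _))))

    esym-cong : ∀ m {xs ys} → xs ≋ ys → esym R m xs ≈ esym R m ys
    esym-cong zero    xs≋ys         = R.refl
    esym-cong (suc m) []            = R.refl
    esym-cong (suc m) (x≈y ∷ xs≋ys) = R.trans (esym-∷ m _ _)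
      (R.trans (R.+-cong (R.*-cong x≈y (esym-cong m xs≋ys)) (esym-cong (suc m) xs≋ys))
               (R.sym (esym-∷ m _ _)))

    _^_ : Carrier → ℕ → Carrier
    g ^ zero  = 1#
    g ^ suc m = g ⊗ (g ^ m)

    esym-replicate : ∀ m t g →
      esym R m (replicate t g) ≈ (g ^ m) ⊗ esym R m (replicate t 1#)
    esym-replicate zero    t       g = R.sym (R.*-identityˡ _)
    esym-replicate (suc m) zero    g = R.sym (R.zeroʳ _)
    esym-replicate (suc m) (suc t) g = begin
      esym R (suc m) (g ∷ replicate t g)
        ≈⟨ esym-∷ m g _ ⟩
      (g ⊗ esym R m (replicate t g)) ⊕ esym R (suc m) (replicate t g)
        ≈⟨ R.+-cong (R.*-congˡ (esym-replicate m t g)) (esym-replicate (suc m) t g) ⟩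
      (g ⊗ ((g ^ m) ⊗ e)) ⊕ ((g ^ suc m) ⊗ e′)
        ≈⟨ R.+-congʳ (R.*-assoc g _ _) ⟨
      ((g ^ suc m) ⊗ e) ⊕ ((g ^ suc m) ⊗ e′)
        ≈⟨ R.distribˡ _ _ _ ⟨
      (g ^ suc m) ⊗ (e ⊕ e′)
        ≈⟨ R.*-congˡ (R.+-congʳ (R.*-identityˡ e)) ⟨
      (g ^ suc m) ⊗ ((1# ⊗ e) ⊕ e′)
        ≈⟨ R.*-congˡ (esym-∷ m 1# _) ⟨
      (g ^ suc m) ⊗ esym R (suc m) (1# ∷ replicate t 1#) ∎
      where
      open SetoidReasoning setoid
      e  = esym R m (replicate t 1#)
      e′ = esym R (suc m) (replicate t 1#)

    ⊆-replicate : ∀ {xs} n g → xs ⊆ replicate n g → xs ≋ replicate (length xs) g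
    ⊆-replicate zero    g []          = []
    ⊆-replicate (suc n) g (_ ∷ʳ xs⊆)  = ⊆-replicate n g xs⊆
    ⊆-replicate (suc n) g (x≈g ∷ xs⊆) = x≈g ∷ ⊆-replicate n g xs⊆

    module Decide (N : ℕ) (size : HasSize R N) where

      open Inverse size using (to; from; to-cong; from-cong; strictlyInverseʳ)

      _≟_ : ∀ x y → Dec (x ≈ y)
      x ≟ y = map′
        (λ eq → R.trans (R.sym (strictlyInverseʳ x)) (R.trans (from-cong eq) (strictlyInverseʳ y)))
        to-cong (to x ≟ᶠ to y)

      decSetoid : DecSetoid c ℓ
      decSetoid = record
        { isDecEquivalence = record { isEquivalence = R.isEquivalence ; _≟_ = _≟_ } }

      open DecSublist decSetoid using (_⊆?_)

      Respects : (List Carrier → Set p) → Set (c ⊔ ℓ ⊔ p)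
      Respects P = ∀ {xs ys} → xs ≋ ys → P xs → P ys

      all-of-length? : {P : List Carrier → Set p} → Respects P → (∀ xs → Dec (P xs)) →
                       ∀ k → Dec (∀ xs → length xs ≡ k → P xs)
      all-of-length? resp P? zero =
        map′ (λ { P[] [] refl → P[] }) (λ h → h [] refl) (P? [])
      all-of-length? resp P? (suc k) = map′
        (λ { h (x ∷ xs) refl → resp (strictlyInverseʳ x ∷ ≋-refl) (h (to x) xs refl) })
        (λ h i xs eq → h (from i ∷ xs) (cong suc eq))
        (all? λ i → all-of-length? (λ eq → resp (R.refl ∷ eq)) (λ xs → P? (from i ∷ xs)) k)

      any-of-length? : {P : List Carrier → Set p} → Respects P → (∀ xs → Dec (P xs)) →
                       ∀ k → Dec (∃ λ xs → length xs ≡ k × P xs)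
      any-of-length? resp P? zero =
        map′ (λ P[] → [] , refl , P[]) (λ { ([] , refl , P[]) → P[] }) (P? [])
      any-of-length? resp P? (suc k) = map′
        (λ { (i , xs , eq , Pxs) → from i ∷ xs , cong suc eq , Pxs })
        (λ { (x ∷ xs , refl , Pxs) →
             to x , xs , refl , resp (R.sym (strictlyInverseʳ x) ∷ ≋-refl) Pxs })
        (any? λ i → any-of-length? (λ eq → resp (R.refl ∷ eq)) (λ xs → P? (from i ∷ xs)) k)

      hasZeroSubsequence? : ∀ t m S → Dec (HasZeroSubsequence R t m S)
      hasZeroSubsequence? t m S = map′
        (λ { (S′ , eq , S′⊆S , e≈0) → S′ , S′⊆S , eq , e≈0 })
        (λ { (S′ , S′⊆S , eq , e≈0) → S′ , eq , S′⊆S , e≈0 })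
        (any-of-length?
          (λ { eq (S′⊆S , e≈0) → ⊆-trans (⊆-reflexive (ListEquality.≋-sym setoid eq)) S′⊆S
                               , R.trans (R.sym (esym-cong m eq)) e≈0 })
          (λ S′ → (S′ ⊆? S) ×-dec (esym R m S′ ≟ 0#)) t)

      forces? : ∀ t m k → Dec (Forces R t m k)
      forces? t m k = map′
        (λ h S k≤ → extend (take-⊆ k S) (h (take k S) (≡.trans (length-take k S) (ℕ.m≤n⇒m⊓n≡m k≤))))
        (λ { h S refl → h S ℕ.≤-refl })
        (all-of-length? (λ eq → extend (⊆-reflexive eq)) (hasZeroSubsequence? t m) k)
        where
        extend : ∀ {S T} → S ⊆ T → HasZeroSubsequence R t m S → HasZeroSubsequence R t m T
        extend S⊆T (S′ , S′⊆S , rest) = S′ , ⊆-trans S′⊆S S⊆T , rest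

      -- One step of the pigeonhole principle: split off the entries equal to r.
      split : ∀ r {rs} xs → All (λ x → Any (x ≈_) (r ∷ rs)) xs →
              ∃ λ n → ∃ λ ys → replicate n r ⊆ xs × ys ⊆ xs ×
              n + length ys ≡ length xs × All (λ x → Any (x ≈_) rs) ys
      split r [] [] = 0 , [] , [] , [] , refl , []
      split r (x ∷ xs) (px ∷ pxs) with split r xs pxs | px
      ... | n , ys , rep , ys⊆ , eq , all | here x≈r =
        suc n , ys , R.sym x≈r ∷ rep , x ∷ʳ ys⊆ , cong suc eq , all
      ... | n , ys , rep , ys⊆ , eq , all | there x∈ =
        n , x ∷ ys , x ∷ʳ rep , R.refl ∷ ys⊆ , ≡.trans (ℕ.+-suc n _) (cong suc eq) , x∈ ∷ all

      replicate-mono : ∀ {t n} r → t ≤ n → replicate t r ⊆ replicate n r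
      replicate-mono {n = zero}  r z≤n       = []
      replicate-mono {n = suc n} r z≤n       = r ∷ʳ replicate-mono r z≤n
      replicate-mono             r (s≤s t≤n) = R.refl ∷ replicate-mono r t≤n

      pigeonhole : ∀ t rs xs → All (λ x → Any (x ≈_) rs) xs → length rs * t < length xs →
                   ∃ λ r → replicate t r ⊆ xs
      pigeonhole t []       (_ ∷ _) (() ∷ _) _
      pigeonhole t (r ∷ rs) xs      pxs      lt with split r xs pxs
      ... | n , ys , rep , ys⊆ , eq , all with ℕ.<-≤-connex n t
      ...   | inj₂ t≤n = r , ⊆-trans (replicate-mono r t≤n) rep
      ...   | inj₁ n<t = map₂ (λ s → ⊆-trans s ys⊆) (pigeonhole t rs ys all
              (ℕ.+-cancelˡ-< t _ _ (ℕ.<-≤-trans lt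
                (ℕ.≤-trans (ℕ.≤-reflexive (≡.sym eq)) (ℕ.+-monoˡ-≤ (length ys) (ℕ.<⇒≤ n<t))))))

      elements : List Carrier
      elements = tabulate from

      ∈-elements : ∀ x → Any (x ≈_) elements
      ∈-elements x = tabulate⁺ (to x) (R.sym (strictlyInverseʳ x))

      forces-bound : ∀ t m → esym R m (replicate t 1#) ≈ 0# →
                     Forces R t m (suc (length elements * t))
      forces-bound t m e≈0 S long with pigeonhole t elements S (universal ∈-elements S) long
      ... | r , rep = replicate t r , rep , length-replicate t
                    , R.trans (esym-replicate m t r) (R.trans (R.*-congˡ e≈0) (R.zeroʳ _))

      ones-zero : ∀ t m k → Forces R t m k → esym R m (replicate t 1#) ≈ 0#
      ones-zero t m k forces
        with forces (replicate k 1#) (ℕ.≤-reflexive (≡.sym (length-replicate k)))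
      ... | S′ , S′⊆ , refl , e≈0 = R.trans (R.sym (esym-cong m (⊆-replicate k 1# S′⊆))) e≈0

  EGZ-exists : Finite R → ∀ t m → ∃ (IsEGZ R t m)
  EGZ-exists (N , size) t m with esym R m (replicate t 1#) ≟ 0#
    where open Decide N size
  ... | no e≉0  = ⊤⁺ , λ j _ forces → e≉0 (Decide.ones-zero N size t m j forces)
  ... | yes e≈0 with least-or-none (Decide.forces? N size t m)
                       (suc (length (Decide.elements N size) * t))
  ...   | inj₁ (k , least) = [ k ] , least
  ...   | inj₂ none = ⊥-elim (none _ (s≤s z≤n) ℕ.≤-refl (Decide.forces-bound N size t m e≈0))

EGZ : (t : ℕ) (R : CommutativeRing c ℓ) → Finite R → (m : ℕ) → ℕ ⁺
EGZ t R finite m = proj₁ (EGZ-exists R finite t m)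

EGZ-spec : (t : ℕ) (R : CommutativeRing c ℓ) (finite : Finite R) (m : ℕ) →
           IsEGZ R t m (EGZ t R finite m)
EGZ-spec t R finite m = proj₂ (EGZ-exists R finite t m)

-- Average the number of zero subsequences over all sequences of length ℓ + s.
-- As eₘ(x, g) = x eₘ₋₁(g) + eₘ(g) is linear in x, induction on m bounds the zeros
-- of eₘ in F^t by m q^(t-1).  The coordinates of F^n are independent, so eₘ vanishes on
-- a proportion of at most (m/q)^n of the t-tuples over F^n, and some sequence of
-- length ℓ + s has at most s zero subsequences.  Dropping the first entry of each
-- of these leaves a sequence of length at least ℓ without any.

module Submission where

open import Algebra.Bundles using (CommutativeRing)
import Algebra.Properties.Ring as RingProperties
open import Data.Fin.Base using (Fin; zero; suc)
open import Data.Fin.Properties using () renaming (_≟_ to _≟ᶠ_)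
open import Data.Integer.Base using (+_)
import Data.Integer.Base as ℤ
import Data.Integer.Properties as ℤ
open import Data.List.Base using (List; []; _∷_; _++_; map; foldr; length; cartesianProductWith; tabulate)
open import Data.List.Membership.Propositional using (_∈_)
open import Data.List.Properties using (length-++; length-map; length-tabulate; map-++; map-∘)
open import Data.List.Relation.Binary.Pointwise using ([]; _∷_)
open import Data.List.Relation.Binary.Sublist.Propositional using (_⊆_; []; _∷_; _∷ʳ_)
import Data.List.Relation.Binary.Sublist.Propositional.Properties as Sublist
open import Data.List.Relation.Unary.All as All using (All; []; _∷_)
import Data.List.Relation.Unary.All.Properties as All
open import Data.List.Relation.Unary.AllPairs using (AllPairs; []; _∷_)
import Data.List.Relation.Unary.AllPairs.Properties as AllPairs
open import Data.List.Relation.Unary.Any as Any using (Any; here; there)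
import Data.List.Relation.Unary.Any.Properties as Any
import Data.List.Relation.Binary.Equality.Setoid as ListEquality
import Data.List.Relation.Binary.Sublist.Setoid as SetoidSublist
open import Data.Nat.Base using (ℕ; zero; suc; _+_; _≤_; NonZero; z≤n; s≤s; _^_)
import Data.Nat.Base as ℕ
import Data.Nat.Properties as ℕ
open import Data.Nat.Combinatorics using (_C_; nCk+nC[k+1]≡[n+1]C[k+1])
open import Data.Nat.ListAction using (sum)
open import Data.Nat.ListAction.Properties using (sum-++)
open import Data.Nat.Tactic.RingSolver using (solve-∀)
open import Data.Product.Base using (∃; _×_; _,_; proj₁; proj₂)
open import Data.Rational.Base using (_/_; _*_; _<_; toℚᵘ)
import Data.Rational.Properties as ℚ
import Data.Rational.Unnormalised.Base as ℚᵘ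
import Data.Rational.Unnormalised.Properties as ℚᵘ
open import Data.Vec.Functional as Vector using (Vector)
open import Function.Base using (_∘_)
open import Function.Bundles using (Inverse)
open import Level using (Level)
open import Relation.Binary.PropositionalEquality
open import Relation.Nullary.Construct.Add.Supremum using ([_]; ⊤⁺)
open import Relation.Nullary.Decidable using (Dec; yes; no; map′)
open import Relation.Nullary.Negation using (¬_; contradiction)
import Relation.Binary.Construct.Add.Supremum.Strict as Strict
open import Defs

private
  variable
    a b c p ℓ₀ : Level
    A : Set a
    B : Set b
    D : Set c

^-distribʳ-* : ∀ a b n → (a ℕ.* b) ^ n ≡ a ^ n ℕ.* b ^ n
^-distribʳ-* a b zero    = refl
^-distribʳ-* a b (suc n) = trans (cong (a ℕ.* b ℕ.*_) (^-distribʳ-* a b n))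
  (interchange a b (a ^ n) (b ^ n))
  where
  interchange : ∀ w x y z → w ℕ.* x ℕ.* (y ℕ.* z) ≡ w ℕ.* y ℕ.* (x ℕ.* z)
  interchange = solve-∀

-- Sums over lists

∑ : List A → (A → ℕ) → ℕ
∑ xs f = sum (map f xs)

infix 5 ∑
syntax ∑ xs (λ x → e) = ∑[ x ∈ xs ] e

∑-cong : ∀ (xs : List A) {f g : A → ℕ} → (∀ x → f x ≡ g x) → ∑ xs f ≡ ∑ xs g
∑-cong []       f≡g = refl
∑-cong (x ∷ xs) f≡g = cong₂ _+_ (f≡g x) (∑-cong xs f≡g)

∑-mono-≤ : ∀ (xs : List A) {f g : A → ℕ} → (∀ x → f x ≤ g x) → ∑ xs f ≤ ∑ xs g
∑-mono-≤ []       f≤g = z≤n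
∑-mono-≤ (x ∷ xs) f≤g = ℕ.+-mono-≤ (f≤g x) (∑-mono-≤ xs f≤g)

∑-const : ∀ (xs : List A) k → (∑[ _ ∈ xs ] k) ≡ length xs ℕ.* k
∑-const []       k = refl
∑-const (_ ∷ xs) k = cong (k ℕ.+_) (∑-const xs k)

∑-zero : ∀ (xs : List A) → (∑[ _ ∈ xs ] 0) ≡ 0
∑-zero []       = refl
∑-zero (_ ∷ xs) = ∑-zero xs

∑-+ : ∀ (xs : List A) (f g : A → ℕ) → (∑[ x ∈ xs ] (f x + g x)) ≡ ∑ xs f + ∑ xs g
∑-+ []       f g = refl
∑-+ (x ∷ xs) f g = trans (cong (f x + g x ℕ.+_) (∑-+ xs f g)) (interchange (f x) (g x) _ _)
  where
  interchange : ∀ w x y z → w + x + (y + z) ≡ w + y + (x + z)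
  interchange = solve-∀

∑-*ˡ : ∀ (xs : List A) k (f : A → ℕ) → (∑[ x ∈ xs ] (k ℕ.* f x)) ≡ k ℕ.* ∑ xs f
∑-*ˡ []       k f = sym (ℕ.*-zeroʳ k)
∑-*ˡ (x ∷ xs) k f = trans (cong (k ℕ.* f x ℕ.+_) (∑-*ˡ xs k f)) (sym (ℕ.*-distribˡ-+ k (f x) _))

∑-*ʳ : ∀ (xs : List A) k (f : A → ℕ) → (∑[ x ∈ xs ] (f x ℕ.* k)) ≡ ∑ xs f ℕ.* k
∑-*ʳ xs k f = trans (∑-cong xs λ x → ℕ.*-comm (f x) k) (trans (∑-*ˡ xs k f) (ℕ.*-comm k _))

∑-map : ∀ (g : A → B) xs f → ∑ (map g xs) f ≡ ∑ xs (f ∘ g)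
∑-map g xs f = cong sum (sym (map-∘ xs))

∑-++ : ∀ (xs ys : List A) f → ∑ (xs ++ ys) f ≡ ∑ xs f + ∑ ys f
∑-++ xs ys f = trans (cong sum (map-++ f xs ys)) (sum-++ (map f xs) (map f ys))

∑-swap : ∀ (xs : List A) (ys : List B) (f : A → B → ℕ) →
         (∑[ x ∈ xs ] ∑[ y ∈ ys ] f x y) ≡ (∑[ y ∈ ys ] ∑[ x ∈ xs ] f x y)
∑-swap []       ys f = sym (∑-zero ys)
∑-swap (x ∷ xs) ys f = trans (cong (∑ ys (f x) ℕ.+_) (∑-swap xs ys f)) (sym (∑-+ ys (f x) _))

∑-cartesianProductWith : ∀ (g : A → B → D) xs ys f →
  ∑ (cartesianProductWith g xs ys) f ≡ (∑[ x ∈ xs ] ∑[ y ∈ ys ] f (g x y))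
∑-cartesianProductWith g []       ys f = refl
∑-cartesianProductWith g (x ∷ xs) ys f = trans (∑-++ (map (g x) ys) _ f)
  (cong₂ _+_ (∑-map (g x) ys f) (∑-cartesianProductWith g xs ys f))

∑≡0⇒All≡0 : ∀ (xs : List A) {f : A → ℕ} → ∑ xs f ≡ 0 → All (λ x → f x ≡ 0) xs
∑≡0⇒All≡0 []       _  = []
∑≡0⇒All≡0 (x ∷ xs) eq = ℕ.m+n≡0⇒m≡0 _ eq ∷ ∑≡0⇒All≡0 xs (ℕ.m+n≡0⇒n≡0 _ eq)

-- An entry with `f x` above `s` uses up at least `suc s` of the total, so the strict inequality
-- passes to the tail. It cannot reach the empty list, where it would read 0 < 0.
averaging : ∀ s (xs : List A) (f : A → ℕ) → ∑ xs f ℕ.< suc s ℕ.* length xs →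
            ∃ λ x → x ∈ xs × f x ≤ s
averaging s []       f lt = contradiction lt (ℕ.<-irrefl (sym (ℕ.*-zeroʳ s)))
averaging s (x ∷ xs) f lt with f x ℕ.≤? s
... | yes fx≤s = x , here refl , fx≤s
... | no  fx≰s with averaging s xs f
                     (ℕ.+-cancelˡ-< (suc s) _ _ (ℕ.≤-<-trans (ℕ.+-monoˡ-≤ _ (ℕ.≰⇒> fx≰s))
                       (ℕ.<-≤-trans lt (ℕ.≤-reflexive (ℕ.*-suc (suc s) (length xs))))))
... | y , y∈xs , fy≤s = y , there y∈xs , fy≤s

-- Indicators of decidable propositions

⟦_⟧ : Dec A → ℕ
⟦ yes _ ⟧ = 1
⟦ no  _ ⟧ = 0

⟦⟧≤1 : (d : Dec A) → ⟦ d ⟧ ≤ 1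
⟦⟧≤1 (yes _) = ℕ.≤-refl
⟦⟧≤1 (no _)  = z≤n

⟦⟧-yes : (d : Dec A) → A → ⟦ d ⟧ ≡ 1
⟦⟧-yes (yes _) _ = refl
⟦⟧-yes (no ¬x) x = contradiction x ¬x

⟦⟧-no : (d : Dec A) → ¬ A → ⟦ d ⟧ ≡ 0
⟦⟧-no (yes x) ¬x = contradiction x ¬x
⟦⟧-no (no _)  _  = refl

-- Once one entry satisfies `P`, exclusivity makes every later indicator 0. This is how uniqueness
-- of a root becomes a count.
∑⟦⟧≤1 : {P : A → Set p} (P? : ∀ x → Dec (P x)) {xs : List A} →
        AllPairs (λ x y → P x → ¬ P y) xs → (∑[ x ∈ xs ] ⟦ P? x ⟧) ≤ 1
∑⟦⟧≤1 P? []                        = z≤n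
∑⟦⟧≤1 P? {x ∷ xs} (x-excl ∷ excl) with P? x
... | no _   = ∑⟦⟧≤1 P? excl
... | yes px = s≤s (ℕ.≤-reflexive (none (All.map (λ h → h px) x-excl)))
  where
  none : ∀ {ys} → All (λ y → ¬ _) ys → (∑[ y ∈ ys ] ⟦ P? y ⟧) ≡ 0
  none []          = refl
  none (¬py ∷ ¬ps) = cong₂ _+_ (⟦⟧-no (P? _) ¬py) (none ¬ps)

-- Tuples and vectors over a list of entries

length-cartesianProductWith : ∀ (g : A → B → D) xs ys →
  length (cartesianProductWith g xs ys) ≡ length xs ℕ.* length ys
length-cartesianProductWith g []       ys = refl
length-cartesianProductWith g (x ∷ xs) ys = trans (length-++ (map (g x) ys))
  (cong₂ _+_ (length-map (g x) ys) (length-cartesianProductWith g xs ys))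

tuples : ℕ → List A → List (List A)
tuples zero    xs = [] ∷ []
tuples (suc t) xs = cartesianProductWith _∷_ xs (tuples t xs)

length-tuples : ∀ t (xs : List A) → length (tuples t xs) ≡ length xs ^ t
length-tuples zero    xs = refl
length-tuples (suc t) xs = trans (length-cartesianProductWith _∷_ xs (tuples t xs))
  (cong (length xs ℕ.*_) (length-tuples t xs))

∈-tuples⇒length : ∀ t {xs : List A} {T} → T ∈ tuples t xs → length T ≡ t
∈-tuples⇒length t {xs} = All.lookup (lengths t xs)
  where
  lengths : ∀ t (xs : List _) → All (λ T → length T ≡ t) (tuples t xs)
  lengths zero    xs = refl ∷ []
  lengths (suc t) xs = prepend xs
    where
    prepend : ∀ ys → All (λ T → length T ≡ suc t) (cartesianProductWith _∷_ ys (tuples t xs))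
    prepend []       = []
    prepend (y ∷ ys) = All.++⁺ (All.map⁺ (All.map (cong suc) (lengths t xs))) (prepend ys)

∑-tuples-suc : ∀ t (xs : List A) f →
  ∑ (tuples (suc t) xs) f ≡ (∑[ x ∈ xs ] ∑[ T ∈ tuples t xs ] f (x ∷ T))
∑-tuples-suc t xs f = ∑-cartesianProductWith _∷_ xs (tuples t xs) f

vectors : ∀ n → List A → List (Vector A n)
vectors zero    xs = Vector.[] ∷ []
vectors (suc n) xs = cartesianProductWith Vector._∷_ xs (vectors n xs)

length-vectors : ∀ n (xs : List A) → length (vectors n xs) ≡ length xs ^ n
length-vectors zero    xs = refl
length-vectors (suc n) xs = trans (length-cartesianProductWith Vector._∷_ xs (vectors n xs))
  (cong (length xs ℕ.*_) (length-vectors n xs))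

∏ : ∀ n → (Fin n → ℕ) → ℕ
∏ n = Vector.foldr ℕ._*_ 1

∏-cong : ∀ n {f g : Fin n → ℕ} → (∀ i → f i ≡ g i) → ∏ n f ≡ ∏ n g
∏-cong zero    f≡g = refl
∏-cong (suc n) f≡g = cong₂ ℕ._*_ (f≡g zero) (∏-cong n (f≡g ∘ suc))

∏-one : ∀ n → ∏ n (λ _ → 1) ≡ 1
∏-one zero    = refl
∏-one (suc n) = trans (ℕ.+-identityʳ _) (∏-one n)

coordinate : ∀ {n} → Fin n → List (Vector A n) → List A
coordinate i = map (λ v → v i)

-- Choosing a tuple of vectors amounts to choosing the tuple of heads and the tuple of tails
-- independently. The induction absorbs the first entry into `f` and `g`, so both must stay
-- arbitrary.
∑-tuples-independent : ∀ t {n} (xs : List A) (vs : List (Vector A n)) f g →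
  (∑[ T ∈ tuples t (cartesianProductWith Vector._∷_ xs vs) ]
    (f (coordinate zero T) ℕ.* g (map Vector.tail T)))
  ≡ ∑ (tuples t xs) f ℕ.* ∑ (tuples t vs) g
∑-tuples-independent zero xs vs f g = simplify (f []) (g [])
  where
  simplify : ∀ x y → x ℕ.* y + 0 ≡ (x + 0) ℕ.* (y + 0)
  simplify = solve-∀
∑-tuples-independent (suc t) xs vs f g = begin
  ∑ (tuples (suc t) xvs) (λ T → f (coordinate zero T) ℕ.* g (map Vector.tail T))
    ≡⟨ ∑-tuples-suc t xvs _ ⟩
  (∑[ w ∈ xvs ] ∑[ T ∈ tuples t xvs ]
    (f (w zero ∷ coordinate zero T) ℕ.* g (Vector.tail w ∷ map Vector.tail T)))
    ≡⟨ ∑-cartesianProductWith Vector._∷_ xs vs _ ⟩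
  (∑[ x ∈ xs ] ∑[ v ∈ vs ] ∑[ T ∈ tuples t xvs ]
    (f (x ∷ coordinate zero T) ℕ.* g (v ∷ map Vector.tail T)))
    ≡⟨ ∑-cong xs (λ x → ∑-cong vs λ v →
         ∑-tuples-independent t xs vs (f ∘ (x ∷_)) (g ∘ (v ∷_))) ⟩
  (∑[ x ∈ xs ] ∑[ v ∈ vs ] (F x ℕ.* G v))
    ≡⟨ ∑-cong xs (λ x → ∑-*ˡ vs (F x) G) ⟩
  (∑[ x ∈ xs ] (F x ℕ.* ∑ vs G))
    ≡⟨ ∑-*ʳ xs (∑ vs G) F ⟩
  ∑ xs F ℕ.* ∑ vs G
    ≡⟨ cong₂ ℕ._*_ (∑-tuples-suc t xs f) (∑-tuples-suc t vs g) ⟨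
  ∑ (tuples (suc t) xs) f ℕ.* ∑ (tuples (suc t) vs) g ∎
  where
  open ≡-Reasoning
  xvs = cartesianProductWith Vector._∷_ xs vs
  F = λ x → ∑[ T ∈ tuples t xs ] f (x ∷ T)
  G = λ v → ∑[ T ∈ tuples t vs ] g (v ∷ T)

-- Splitting off one coordinate at a time yields `n` equal factors. With a zero indicator for `f`, a
-- count over the field becomes its `n`-th power over the vectors.
∑-tuples-vectors : ∀ t n (xs : List A) f →
  (∑[ T ∈ tuples t (vectors n xs) ] ∏ n (λ i → f (coordinate i T))) ≡ ∑ (tuples t xs) f ^ n
∑-tuples-vectors t zero    xs f = begin
  -- There is exactly one vector of dimension 0, hence one tuple, even when `xs` is empty.
  (∑[ T ∈ tuples t (vectors 0 xs) ] 1)     ≡⟨ ∑-const (tuples t (vectors 0 xs)) 1 ⟩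
  length (tuples t (vectors 0 xs)) ℕ.* 1   ≡⟨ ℕ.*-identityʳ _ ⟩
  length (tuples t (vectors 0 xs))         ≡⟨ length-tuples t (vectors 0 xs) ⟩
  1 ^ t                                    ≡⟨ ℕ.^-zeroˡ t ⟩
  1                                        ∎
  where open ≡-Reasoning
∑-tuples-vectors t (suc n) xs f = begin
  (∑[ T ∈ tuples t (vectors (suc n) xs) ] ∏ (suc n) (λ i → f (coordinate i T)))
    ≡⟨ ∑-cong (tuples t (vectors (suc n) xs)) (λ T →
         cong (f (coordinate zero T) ℕ.*_) (∏-cong n λ i → cong f (map-∘ T))) ⟩
  (∑[ T ∈ tuples t (vectors (suc n) xs) ]
    (f (coordinate zero T) ℕ.* ∏ n (λ i → f (coordinate i (map Vector.tail T)))))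
    ≡⟨ ∑-tuples-independent t xs (vectors n xs) f _ ⟩
  ∑ (tuples t xs) f ℕ.* (∑[ T ∈ tuples t (vectors n xs) ] ∏ n (λ i → f (coordinate i T)))
    ≡⟨ cong (∑ (tuples t xs) f ℕ.*_) (∑-tuples-vectors t n xs f) ⟩
  ∑ (tuples t xs) f ^ suc n ∎
  where open ≡-Reasoning

-- Combinations

∑-combinations-suc : ∀ t (x : A) S f → ∑ (combinations (suc t) (x ∷ S)) f
  ≡ (∑[ T ∈ combinations t S ] f (x ∷ T)) + ∑ (combinations (suc t) S) f
∑-combinations-suc t x S f = trans (∑-++ (map (x ∷_) (combinations t S)) _ f)
  (cong (_+ ∑ (combinations (suc t) S) f) (∑-map (x ∷_) (combinations t S) f))

-- Each t-combination of a uniformly random N-tuple is a uniformly random t-tuple.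
∑-tuples-combinations : ∀ N t (xs : List A) f →
  length xs ^ t ℕ.* (∑[ S ∈ tuples N xs ] ∑ (combinations t S) f)
  ≡ (N C t) ℕ.* length xs ^ N ℕ.* ∑ (tuples t xs) f
∑-tuples-combinations N zero xs f = begin
  1 ℕ.* (∑[ S ∈ tuples N xs ] (f [] + 0))     ≡⟨ ℕ.*-identityˡ _ ⟩
  (∑[ S ∈ tuples N xs ] (f [] + 0))           ≡⟨ ∑-const (tuples N xs) _ ⟩
  length (tuples N xs) ℕ.* (f [] + 0)         ≡⟨ cong (ℕ._* (f [] + 0)) (length-tuples N xs) ⟩
  length xs ^ N ℕ.* (f [] + 0)                ≡⟨ cong (ℕ._* (f [] + 0)) (ℕ.*-identityˡ (length xs ^ N)) ⟨
  1 ℕ.* length xs ^ N ℕ.* (f [] + 0)          ∎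
  where open ≡-Reasoning
∑-tuples-combinations zero    (suc t) xs f = ℕ.*-zeroʳ (length xs ^ suc t)
∑-tuples-combinations (suc N) (suc t) xs f = begin
  Q ^ suc t ℕ.* (∑[ S ∈ tuples (suc N) xs ] ∑ (combinations (suc t) S) f)
    ≡⟨ cong (Q ^ suc t ℕ.*_) split ⟩
  Q ℕ.* Q ^ t ℕ.* (∑ xs first + Q ℕ.* rest)
    -- The first summand needs only `Q ^ t` for its induction and keeps a spare `Q`; the second
    -- needs all of `Q ^ suc t` but has a `Q` from the free choice of the head. Either `Q` later
    -- turns `Q ^ N` into `Q ^ suc N`.
    ≡⟨ distribute Q (Q ^ t) (∑ xs first) rest ⟩
  Q ℕ.* (Q ^ t ℕ.* ∑ xs first) + Q ℕ.* (Q ^ suc t ℕ.* rest)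
    ≡⟨ cong₂ (λ u v → Q ℕ.* u + Q ℕ.* v) firsts (∑-tuples-combinations N (suc t) xs f) ⟩
  Q ℕ.* ((N C t) ℕ.* Q ^ N ℕ.* W) + Q ℕ.* ((N C suc t) ℕ.* Q ^ N ℕ.* W)
    ≡⟨ collect Q (N C t) (N C suc t) (Q ^ N) W ⟩
  ((N C t) + (N C suc t)) ℕ.* Q ^ suc N ℕ.* W
    ≡⟨ cong (λ k → k ℕ.* Q ^ suc N ℕ.* W) (nCk+nC[k+1]≡[n+1]C[k+1] N t) ⟩
  (suc N C suc t) ℕ.* Q ^ suc N ℕ.* W ∎
  where
  open ≡-Reasoning
  Q = length xs
  W = ∑ (tuples (suc t) xs) f
  first = λ x → ∑[ S ∈ tuples N xs ] ∑[ T ∈ combinations t S ] f (x ∷ T)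
  rest = ∑[ S ∈ tuples N xs ] ∑ (combinations (suc t) S) f

  -- The combinations that avoid the head `x` do not depend on it, whence the factor `Q` before
  -- `rest`.
  split : (∑[ S ∈ tuples (suc N) xs ] ∑ (combinations (suc t) S) f) ≡ ∑ xs first + Q ℕ.* rest
  split = begin
    (∑[ S ∈ tuples (suc N) xs ] ∑ (combinations (suc t) S) f)
      ≡⟨ ∑-tuples-suc N xs _ ⟩
    (∑[ x ∈ xs ] ∑[ S ∈ tuples N xs ] ∑ (combinations (suc t) (x ∷ S)) f)
      ≡⟨ ∑-cong xs (λ x → trans (∑-cong (tuples N xs) λ S → ∑-combinations-suc t x S f)
                                (∑-+ (tuples N xs) _ _)) ⟩
    (∑[ x ∈ xs ] (first x + rest))
      ≡⟨ ∑-+ xs first _ ⟩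
    ∑ xs first + (∑[ x ∈ xs ] rest)
      ≡⟨ cong (∑ xs first ℕ.+_) (∑-const xs rest) ⟩
    ∑ xs first + Q ℕ.* rest ∎

  firsts : Q ^ t ℕ.* ∑ xs first ≡ (N C t) ℕ.* Q ^ N ℕ.* W
  firsts = begin
    Q ^ t ℕ.* ∑ xs first
      ≡⟨ ∑-*ˡ xs (Q ^ t) first ⟨
    (∑[ x ∈ xs ] (Q ^ t ℕ.* first x))
      ≡⟨ ∑-cong xs (λ x → ∑-tuples-combinations N t xs (f ∘ (x ∷_))) ⟩
    (∑[ x ∈ xs ] ((N C t) ℕ.* Q ^ N ℕ.* (∑[ T ∈ tuples t xs ] f (x ∷ T))))
      ≡⟨ ∑-*ˡ xs ((N C t) ℕ.* Q ^ N) _ ⟩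
    (N C t) ℕ.* Q ^ N ℕ.* (∑[ x ∈ xs ] ∑[ T ∈ tuples t xs ] f (x ∷ T))
      ≡⟨ cong ((N C t) ℕ.* Q ^ N ℕ.*_) (∑-tuples-suc t xs f) ⟨
    (N C t) ℕ.* Q ^ N ℕ.* W ∎

  distribute : ∀ Q P u v → Q ℕ.* P ℕ.* (u + Q ℕ.* v) ≡ Q ℕ.* (P ℕ.* u) + Q ℕ.* (Q ℕ.* P ℕ.* v)
  distribute = solve-∀

  collect : ∀ Q j k P w → Q ℕ.* (j ℕ.* P ℕ.* w) + Q ℕ.* (k ℕ.* P ℕ.* w) ≡ (j + k) ℕ.* (Q ℕ.* P) ℕ.* w
  collect = solve-∀

-- Lets `prune` pass the vanishing of `f` from the combinations of `S` down to those of the kept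
-- entries `S′`.
combinations-⊆ : ∀ t {S S′ : List A} → S′ ⊆ S → combinations t S′ ⊆ combinations t S
combinations-⊆ zero    S′⊆S               = refl ∷ []
combinations-⊆ (suc t) []                 = []
combinations-⊆ (suc t) (y ∷ʳ S′⊆S)         =
  Sublist.++⁺ˡ (map (y ∷_) (combinations t _)) (combinations-⊆ (suc t) S′⊆S)
combinations-⊆ (suc t) (_∷_ {x} refl S′⊆S) =
  Sublist.++⁺ (Sublist.map⁺ (x ∷_) (combinations-⊆ t S′⊆S)) (combinations-⊆ (suc t) S′⊆S)

-- An entry is dropped iff f is nonzero on some combination starting with it.
prune : ∀ t (f : List A → ℕ) S → ∃ λ S′ →
  S′ ⊆ S × length S ≤ length S′ + ∑ (combinations (suc t) S) f ×
  All (λ T → f T ≡ 0) (combinations (suc t) S′)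
prune t f []      = [] , [] , z≤n , []
prune t f (x ∷ S) rewrite ∑-combinations-suc t x S f with prune t f S
... | S′ , S′⊆S , len , none with ∑ (combinations t S) (f ∘ (x ∷_)) in eq
-- No combination of `S` becomes bad when `x` is put in front, so none of `S′` does, and `x` can
-- stay.
...   | zero  = x ∷ S′ , refl ∷ S′⊆S , s≤s len ,
  All.++⁺ (All.map⁺ (Sublist.All-resp-⊆ (combinations-⊆ t S′⊆S)
             (∑≡0⇒All≡0 (combinations t S) eq))) none
-- A positive contribution of the combinations starting with `x` pays for the loss of one entry; the
-- surplus `k` is given away.
...   | suc k = S′ , x ∷ʳ S′⊆S ,
  ℕ.≤-trans (s≤s (ℕ.≤-trans len (ℕ.+-monoʳ-≤ (length S′) (ℕ.m≤n+m _ k))))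
            (ℕ.≤-reflexive (sym (ℕ.+-suc (length S′) _))) ,
  none

-- Elementary symmetric polynomials

module _ (R : CommutativeRing c ℓ₀) where

  private
    module R = CommutativeRing R
  open ListEquality R.setoid using (_≋_)
  open SetoidSublist R.setoid using () renaming (_⊆_ to _⊆ₛ_)

  -- Connects the sublists in `HasZeroSubsequence` with the enumeration used for counting. Setoid
  -- sublists match entries only up to equivalence, hence `≋`.
  ⊆ₛ⇒∈-combinations : ∀ {T S} → T ⊆ₛ S → Any (T ≋_) (combinations (length T) S)
  ⊆ₛ⇒∈-combinations {[]}    _                     = here []
  ⊆ₛ⇒∈-combinations {_ ∷ _} (y SetoidSublist.∷ʳ T⊆S)  =
    Any.++⁺ʳ (map (y ∷_) _) (⊆ₛ⇒∈-combinations T⊆S)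
  ⊆ₛ⇒∈-combinations {_ ∷ _} (x≈y SetoidSublist.∷ T⊆S) =
    Any.++⁺ˡ (Any.map⁺ (Any.map (x≈y ∷_) (⊆ₛ⇒∈-combinations T⊆S)))

  esym-zero : ∀ xs → esym R 0 xs R.≈ R.1#
  esym-zero xs = R.+-identityʳ R.1#

  esym-suc : ∀ m x xs →
    esym R (suc m) (x ∷ xs) R.≈ x R.* esym R m xs R.+ esym R (suc m) xs
  esym-suc m x xs = go (combinations m xs)
    where
    sumOfProducts = λ css →
      foldr R._+_ R.0# (map (foldr R._*_ R.1#) css)
    rest = combinations (suc m) xs

    -- With an arbitrary `css` in place of `combinations m xs`, induction can run over the list of
    -- choices.
    go : ∀ css → sumOfProducts (map (x ∷_) css ++ rest) R.≈
                 x R.* sumOfProducts css R.+ sumOfProducts rest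
    go []         = R.sym (R.trans (R.+-congʳ (R.zeroʳ x)) (R.+-identityˡ _))
    go (cs ∷ css) = R.trans (R.+-congˡ (go css))
      (R.trans (R.sym (R.+-assoc _ _ _)) (R.+-congʳ (R.sym (R.distribˡ x _ _))))

  esym-cong : ∀ m {xs ys} → xs ≋ ys → esym R m xs R.≈ esym R m ys
  esym-cong zero    _             = R.refl
  esym-cong (suc m) []            = R.refl
  esym-cong (suc m) (x≈y ∷ xs≋ys) = R.trans (esym-suc m _ _)
    (R.trans (R.+-cong (R.*-cong x≈y (esym-cong m xs≋ys)) (esym-cong (suc m) xs≋ys))
             (R.sym (esym-suc m _ _)))

-- The operations of `Power R n` are coordinatewise, so evaluation at `i` respects the recursion
-- `esym-suc` on both sides.
esym-coordinate : ∀ (R : CommutativeRing c ℓ₀) {n} m T i →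
  CommutativeRing._≈_ R (esym (Power R n) m T i) (esym R m (coordinate i T))
esym-coordinate R     zero    T       i = CommutativeRing.refl R
esym-coordinate R     (suc m) []      i = CommutativeRing.refl R
esym-coordinate R {n} (suc m) (v ∷ T) i = R.trans (esym-suc (Power R n) m v T i)
  (R.trans (R.+-cong (R.*-congˡ (esym-coordinate R m T i)) (esym-coordinate R (suc m) T i))
           (R.sym (esym-suc R m (v i) (coordinate i T))))
  where module R = CommutativeRing R

-- Zeros over a finite field

module _ {q} (F : FiniteField c ℓ₀ q) where

  open FiniteField F
  private
    module F = CommutativeRing commutativeRing
    open F using (_≈_; 0#; 1#)
    open RingProperties F.ring using (+-cancelʳ)
    open Inverse hasSize

    R = commutativeRing

  infix 4 _≟_
  _≟_ : ∀ x y → Dec (x ≈ y)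
  x ≟ y = map′
    (λ eq → F.trans (F.sym (strictlyInverseʳ x)) (F.trans (from-cong eq) (strictlyInverseʳ y)))
    to-cong (to x ≟ᶠ to y)

  elements : List F.Carrier
  elements = tabulate from

  length-elements : length elements ≡ q
  length-elements = length-tabulate from

  *-cancelʳ-nonZero : ∀ {x y z} → ¬ (z ≈ 0#) → x F.* z ≈ y F.* z → x ≈ y
  *-cancelʳ-nonZero {x} {y} {z} z≉0 xz≈yz with proj₂ isField z z≉0
  ... | z⁻¹ , zz⁻¹≈1 = begin
    x                 ≈⟨ F.*-identityʳ x ⟨
    x F.* 1#          ≈⟨ F.*-congˡ zz⁻¹≈1 ⟨
    x F.* (z F.* z⁻¹) ≈⟨ F.*-assoc x z z⁻¹ ⟨
    x F.* z F.* z⁻¹   ≈⟨ F.*-congʳ xz≈yz ⟩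
    y F.* z F.* z⁻¹   ≈⟨ F.*-assoc y z z⁻¹ ⟩
    y F.* (z F.* z⁻¹) ≈⟨ F.*-congˡ zz⁻¹≈1 ⟩
    y F.* 1#          ≈⟨ F.*-identityʳ y ⟩
    y                 ∎
    where open import Relation.Binary.Reasoning.Setoid F.setoid

  isZero : ℕ → List F.Carrier → ℕ
  isZero m xs = ⟦ esym R m xs ≟ 0# ⟧

  zeroCount : ℕ → ℕ → ℕ
  zeroCount t m = ∑ (tuples t elements) (isZero m)

  -- In `x`, the value is linear with slope `esym R m T`. A vanishing slope gets the trivial bound
  -- `q`; a nonzero slope leaves at most one root.
  ∑-isZero-suc : ∀ m T → (∑[ x ∈ elements ] isZero (suc m) (x ∷ T)) ≤ q ℕ.* isZero m T + 1
  ∑-isZero-suc m T with esym R m T ≟ 0#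
  ... | yes _ = begin
    (∑[ x ∈ elements ] isZero (suc m) (x ∷ T))  ≤⟨ ∑-mono-≤ elements (λ x → ⟦⟧≤1 (_ ≟ 0#)) ⟩
    (∑[ x ∈ elements ] 1)                       ≡⟨ ∑-const elements 1 ⟩
    length elements ℕ.* 1                       ≡⟨ cong (ℕ._* 1) length-elements ⟩
    q ℕ.* 1                                     ≤⟨ ℕ.m≤m+n (q ℕ.* 1) 1 ⟩
    q ℕ.* 1 + 1                                 ∎
    where open ℕ.≤-Reasoning
  ... | no e≉0 = ℕ.≤-trans
    (∑⟦⟧≤1 (λ x → esym R (suc m) (x ∷ T) ≟ 0#) (AllPairs.tabulate⁺ distinct))
    (ℕ.m≤n+m 1 (q ℕ.* 0))
    where
    distinct : ∀ {i j} → i ≢ j → esym R (suc m) (from i ∷ T) ≈ 0# →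
               ¬ (esym R (suc m) (from j ∷ T) ≈ 0#)
    distinct i≢j zero-i zero-j = i≢j
      (trans (sym (strictlyInverseˡ _)) (trans (to-cong from-i≈from-j) (strictlyInverseˡ _)))
      where
      -- For two roots, subtract the common constant term `esym R (suc m) T`, then cancel the
      -- nonzero slope.
      from-i≈from-j = *-cancelʳ-nonZero e≉0 (+-cancelʳ _ _ _
        (F.trans (F.sym (esym-suc R m _ T))
          (F.trans zero-i (F.trans (F.sym zero-j) (esym-suc R m _ T)))))

  -- Multiplying by `q` avoids the exponent `t - 1`. Fixing the tail and counting heads costs `q`
  -- for each tail with vanishing slope, plus 1 for every tail, which adds one `q ^ t` per step of
  -- `m`.
  zeroCount-bound : ∀ t m → m ≤ t → q ℕ.* zeroCount t m ≤ m ℕ.* q ^ t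
  -- For `m = 0` the value is always 1, which differs from 0 in a field, so there are no zeros.
  zeroCount-bound t zero m≤t = ℕ.≤-reflexive (trans (cong (q ℕ.*_)
    (trans (∑-cong (tuples t elements) λ T → ⟦⟧-no (esym R 0 T ≟ 0#)
             λ e≈0 → proj₁ isField (F.trans (F.sym (esym-zero R T)) e≈0))
           (∑-zero (tuples t elements))))
    (ℕ.*-zeroʳ q))
  zeroCount-bound (suc t) (suc m) (s≤s m≤t) = begin
    q ℕ.* zeroCount (suc t) (suc m)
      ≡⟨ cong (q ℕ.*_) (trans (∑-tuples-suc t elements (isZero (suc m)))
                              (∑-swap elements (tuples t elements) _)) ⟩
    q ℕ.* (∑[ T ∈ tuples t elements ] ∑[ x ∈ elements ] isZero (suc m) (x ∷ T))
      ≤⟨ ℕ.*-monoʳ-≤ q (∑-mono-≤ (tuples t elements) (∑-isZero-suc m)) ⟩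
    q ℕ.* (∑[ T ∈ tuples t elements ] (q ℕ.* isZero m T + 1))
      ≡⟨ cong (q ℕ.*_) (trans (∑-+ (tuples t elements) _ _)
           (cong₂ _+_ (∑-*ˡ (tuples t elements) q (isZero m))
             (trans (∑-const (tuples t elements) 1)
               (trans (ℕ.*-identityʳ _)
                 (trans (length-tuples t elements) (cong (_^ t) length-elements)))))) ⟩
    q ℕ.* (q ℕ.* zeroCount t m + q ^ t)
      ≤⟨ ℕ.*-monoʳ-≤ q (ℕ.+-monoˡ-≤ (q ^ t) (zeroCount-bound t m m≤t)) ⟩
    q ℕ.* (m ℕ.* q ^ t + q ^ t)
      ≡⟨ collect q m (q ^ t) ⟩
    suc m ℕ.* q ^ suc t ∎
    where
    open ℕ.≤-Reasoning
    collect : ∀ q m r → q ℕ.* (m ℕ.* r + r) ≡ (1 + m) ℕ.* (q ℕ.* r)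
    collect = solve-∀

  -- Zero subsequences over powers of the field

  isZeroᵛ : ∀ n → ℕ → List (Vector F.Carrier n) → ℕ
  isZeroᵛ n m T = ∏ n (λ i → isZero m (coordinate i T))

  -- `isZeroᵛ` is a product with one indicator per coordinate so that `∑-tuples-vectors` can factor
  -- its sum. At a zero of `esym` in `Power R n` all these factors are 1.
  isZeroᵛ≢0 : ∀ n m {T} → (∀ i → esym (Power R n) m T i ≈ 0#) → isZeroᵛ n m T ≢ 0
  isZeroᵛ≢0 n m {T} e≈0 eq = ℕ.1+n≢0 (trans (sym (trans
    (∏-cong n λ i → ⟦⟧-yes (_ ≟ 0#) (F.trans (F.sym (esym-coordinate R m T i)) (e≈0 i)))
    (∏-one n))) eq)

  -- With `z` zeros among the `q ^ t` tuples over the field, the mean number of zero combinations is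
  -- (N C t)(z / q^t)^n, at most (N C t)(m / q)^n and so below `suc s`. The proof compares these
  -- after multiplication by `q ^ n` and `Q ^ t`.
  fewZeroCombinations : .{{_ : NonZero q}} → ∀ n t m N s → m ≤ t →
    (N C t) ℕ.* m ^ n ℕ.< suc s ℕ.* q ^ n →
    ∃ λ S → length S ≡ N × ∑ (combinations t S) (isZeroᵛ n m) ≤ s
  fewZeroCombinations n t m N s m≤t bound =
    let S , S∈ , few = averaging s (tuples N X) bad (ℕ.*-cancelˡ-< (q ^ n ℕ.* Q ^ t) _ _ scaled)
    in S , ∈-tuples⇒length N S∈ , few
    where
    X = vectors n elements
    Q = length X
    z = zeroCount t m
    bad = λ S → ∑ (combinations t S) (isZeroᵛ n m)

    Q≡q^n : Q ≡ q ^ n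
    Q≡q^n = trans (length-vectors n elements) (cong (_^ n) length-elements)

    [q^t]^n≡Q^t : (q ^ t) ^ n ≡ Q ^ t
    [q^t]^n≡Q^t = trans (ℕ.^-*-assoc q t n) (trans (cong (q ^_) (ℕ.*-comm t n))
      (trans (sym (ℕ.^-*-assoc q n t)) (cong (_^ t) (sym Q≡q^n))))

    -- Keeps the inequality strict when `bound` is multiplied by powers of `Q`.
    Q^k≢0 : ∀ k → NonZero (Q ^ k)
    Q^k≢0 k = ℕ.m^n≢0 Q k {{subst NonZero (sym Q≡q^n) (ℕ.m^n≢0 q n)}}

    scaled : q ^ n ℕ.* Q ^ t ℕ.* ∑ (tuples N X) bad
             ℕ.< q ^ n ℕ.* Q ^ t ℕ.* (suc s ℕ.* length (tuples N X))
    scaled = begin-strict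
      q ^ n ℕ.* Q ^ t ℕ.* ∑ (tuples N X) bad
        ≡⟨ ℕ.*-assoc (q ^ n) (Q ^ t) _ ⟩
      q ^ n ℕ.* (Q ^ t ℕ.* ∑ (tuples N X) bad)
        ≡⟨ cong (q ^ n ℕ.*_) (trans (∑-tuples-combinations N t X (isZeroᵛ n m))
             (cong ((N C t) ℕ.* Q ^ N ℕ.*_) (∑-tuples-vectors t n elements (isZero m)))) ⟩
      q ^ n ℕ.* ((N C t) ℕ.* Q ^ N ℕ.* z ^ n)
        ≡⟨ gather (q ^ n) (N C t) (Q ^ N) (z ^ n) ⟩
      (N C t) ℕ.* Q ^ N ℕ.* (q ^ n ℕ.* z ^ n)
        -- Each of the `n` factors `z` receives the `q` that `zeroCount-bound` asks for.
        ≡⟨ cong ((N C t) ℕ.* Q ^ N ℕ.*_) (^-distribʳ-* q z n) ⟨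
      (N C t) ℕ.* Q ^ N ℕ.* (q ℕ.* z) ^ n
        ≤⟨ ℕ.*-monoʳ-≤ ((N C t) ℕ.* Q ^ N) (ℕ.^-monoˡ-≤ n (zeroCount-bound t m m≤t)) ⟩
      (N C t) ℕ.* Q ^ N ℕ.* (m ℕ.* q ^ t) ^ n
        ≡⟨ cong ((N C t) ℕ.* Q ^ N ℕ.*_) (^-distribʳ-* m (q ^ t) n) ⟩
      (N C t) ℕ.* Q ^ N ℕ.* (m ^ n ℕ.* (q ^ t) ^ n)
        ≡⟨ cong (λ k → (N C t) ℕ.* Q ^ N ℕ.* (m ^ n ℕ.* k)) [q^t]^n≡Q^t ⟩
      (N C t) ℕ.* Q ^ N ℕ.* (m ^ n ℕ.* Q ^ t)
        ≡⟨ regroup (N C t) (Q ^ N) (m ^ n) (Q ^ t) ⟩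
      (N C t) ℕ.* m ^ n ℕ.* (Q ^ N ℕ.* Q ^ t)
        <⟨ ℕ.*-monoˡ-< (Q ^ N ℕ.* Q ^ t) {{ℕ.m*n≢0 (Q ^ N) (Q ^ t) {{Q^k≢0 N}} {{Q^k≢0 t}}}} bound ⟩
      suc s ℕ.* q ^ n ℕ.* (Q ^ N ℕ.* Q ^ t)
        ≡⟨ rearrange (suc s) (q ^ n) (Q ^ N) (Q ^ t) ⟩
      q ^ n ℕ.* Q ^ t ℕ.* (suc s ℕ.* Q ^ N)
        ≡⟨ cong (λ k → q ^ n ℕ.* Q ^ t ℕ.* (suc s ℕ.* k)) (length-tuples N X) ⟨
      q ^ n ℕ.* Q ^ t ℕ.* (suc s ℕ.* length (tuples N X)) ∎
      where
      open ℕ.≤-Reasoning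
      gather : ∀ a b c d → a ℕ.* (b ℕ.* c ℕ.* d) ≡ b ℕ.* c ℕ.* (a ℕ.* d)
      gather = solve-∀
      regroup : ∀ a b c d → a ℕ.* b ℕ.* (c ℕ.* d) ≡ a ℕ.* c ℕ.* (b ℕ.* d)
      regroup = solve-∀
      rearrange : ∀ a b c d → a ℕ.* b ℕ.* (c ℕ.* d) ≡ b ℕ.* d ℕ.* (a ℕ.* c)
      rearrange = solve-∀

  -- A zero subsequence would agree up to `≋` with a listed combination, and `esym` respects `≋`, so
  -- `isZeroᵛ` would be nonzero there.
  zeroFree : ∀ n t m S → All (λ T → isZeroᵛ n m T ≡ 0) (combinations t S) →
             ¬ HasZeroSubsequence (Power R n) t m S
  zeroFree n t m S none (T , T⊆S , refl , e≈0) =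
    All.lookupWith contradict none (⊆ₛ⇒∈-combinations (Power R n) T⊆S)
    where
    open ListEquality (CommutativeRing.setoid (Power R n)) using (_≋_)
    contradict : ∀ {T′} → isZeroᵛ n m T′ ≡ 0 → ¬ (T ≋ T′)
    contradict {T′} isZero≡0 T≋T′ = isZeroᵛ≢0 n m {T′}
      (λ i → F.trans (F.sym (esym-cong (Power R n) m T≋T′ i)) (e≈0 i)) isZero≡0

  -- The `s` extra positions pay for the entries that `prune` removes. Positivity of `t` ensures
  -- that each bad combination has a first entry to drop.
  longZeroFree : .{{_ : NonZero q}} → ∀ n t m ℓ s → 1 ≤ t → m ≤ t →
    ((ℓ + s) C t) ℕ.* m ^ n ℕ.< suc s ℕ.* q ^ n →
    ∃ λ S → ℓ ≤ length S × ¬ HasZeroSubsequence (Power R n) t m S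
  longZeroFree n (suc t) m ℓ s _ m≤t bound =
    let S , len , few         = fewZeroCombinations n (suc t) m (ℓ + s) s m≤t bound
        S′ , _ , len′ , none = prune t (isZeroᵛ n m) S
    in S′ , ℕ.+-cancelʳ-≤ s ℓ (length S′) (ℕ.≤-trans (ℕ.≤-reflexive (sym len))
              (ℕ.≤-trans len′ (ℕ.+-monoʳ-≤ (length S′) few)))
          , zeroFree n (suc t) m S′ none

-- Clearing denominators

toℚᵘ-/ : ∀ i d .{{_ : NonZero d}} → toℚᵘ (i / d) ℚᵘ.≃ (i ℚᵘ./ d)
toℚᵘ-/ i (suc d) = ℚ.toℚᵘ-fromℚᵘ (ℚᵘ.mkℚᵘ i d)

/-*-/ : ∀ a b c d .{{_ : NonZero b}} .{{_ : NonZero d}} →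
        (+ a / b) * (+ c / d) ≡ _/_ (+ (a ℕ.* c)) (b ℕ.* d) {{ℕ.m*n≢0 b d}}
/-*-/ a b@(suc _) c d@(suc _) = ℚ.toℚᵘ-injective (begin
  toℚᵘ ((+ a / b) * (+ c / d))          ≈⟨ ℚ.toℚᵘ-homo-* (+ a / b) (+ c / d) ⟩
  toℚᵘ (+ a / b) ℚᵘ.* toℚᵘ (+ c / d)    ≈⟨ ℚᵘ.*-cong (toℚᵘ-/ (+ a) b) (toℚᵘ-/ (+ c) d) ⟩
  (+ a ℤ.* + c) ℚᵘ./ (b ℕ.* d)          ≡⟨ cong (λ i → i ℚᵘ./ (b ℕ.* d)) (ℤ.pos-* a c) ⟨
  + (a ℕ.* c) ℚᵘ./ (b ℕ.* d)            ≈⟨ toℚᵘ-/ (+ (a ℕ.* c)) (b ℕ.* d) ⟨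
  toℚᵘ (+ (a ℕ.* c) / (b ℕ.* d))        ∎)
  where open ℚᵘ.≃-Reasoning

/-^ : ∀ m q .{{_ : NonZero q}} n → (+ m / q) ^ℚ n ≡ _/_ (+ (m ^ n)) (q ^ n) {{ℕ.m^n≢0 q n}}
/-^ m q zero    = refl
/-^ m q {{q≢0}} (suc n) = trans (cong ((+ m / q) *_) (/-^ m q n))
  (/-*-/ m q (m ^ n) (q ^ n) {{q≢0}} {{ℕ.m^n≢0 q n}})

/-cancel-< : ∀ a b c d .{{_ : NonZero b}} .{{_ : NonZero d}} →
             + a / b < + c / d → a ℕ.* d ℕ.< c ℕ.* b
/-cancel-< a b@(suc _) c d@(suc _) lt = ℤ.drop‿+<+
  (subst₂ ℤ._<_ (sym (ℤ.pos-* a d)) (sym (ℤ.pos-* c b))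
  (ℚᵘ.drop-*<* (ℚᵘ.<-respˡ-≃ (toℚᵘ-/ (+ a) b) (ℚᵘ.<-respʳ-≃ (toℚᵘ-/ (+ c) d) (ℚ.toℚᵘ-mono-< lt)))))

-- Carries the rational hypothesis over to the natural numbers, where all the counting takes place.
clear-denominators : ∀ N m q .{{_ : NonZero q}} n k →
  (+ N / 1) * ((+ m / q) ^ℚ n) < (+ k / 1) → N ℕ.* m ^ n ℕ.< k ℕ.* q ^ n
clear-denominators N m q n k lt =
  subst₂ ℕ._<_ (ℕ.*-identityʳ _) (cong (k ℕ.*_) (ℕ.*-identityˡ (q ^ n)))
  (/-cancel-< (N ℕ.* m ^ n) (1 ℕ.* q ^ n) k 1 {{nz}} (subst (_< (+ k / 1))
    (trans (cong ((+ N / 1) *_) (/-^ m q n)) (/-*-/ N 1 (m ^ n) (q ^ n) {{_}} {{ℕ.m^n≢0 q n}})) lt))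
  where
  nz : NonZero (1 ℕ.* q ^ n)
  nz = ℕ.m*n≢0 1 (q ^ n) {{_}} {{ℕ.m^n≢0 q n}}

-- The lower bound for the EGZ constant

theorem2p5 : ∀ {c ℓ₀} (q : ℕ) .{{_ : NonZero q}} → IsPrimePower q →
    (F : FiniteField c ℓ₀ q) → let open FiniteField F in
    (n t m : ℕ) → 1 ≤ n → 1 ≤ t → 1 ≤ m → m ≤ t →
    (ℓ : ℕ) → 1 ≤ ℓ →
    (∃ λ s → (+ ((ℓ + s) C t) / 1) * ((+ m / q) ^ℚ n) < (+ (s + 1) / 1)) →
    [ ℓ ] <⁺ EGZ t (Power commutativeRing n) (Power-finite commutativeRing (q , hasSize) n) m
theorem2p5 q _ F n t m _ 1≤t _ m≤t ℓ _ (s , bound)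
  with longZeroFree F n t m ℓ s 1≤t m≤t
         (subst (λ k → ((ℓ + s) C t) ℕ.* m ^ n ℕ.< k ℕ.* q ^ n) (ℕ.+-comm s 1)
           (clear-denominators ((ℓ + s) C t) m q n (s + 1) bound))
     -- Abstracting the value together with its specification allows a case split into finite and
     -- infinite.
     | EGZ t (Power R n) finite m | EGZ-spec t (Power R n) finite m
  where
  R = FiniteField.commutativeRing F
  finite = Power-finite R (q , FiniteField.hasSize F) n
... | S , ℓ≤ , zeroFree | [ k ] | _ , forces , _ =
  -- If `k ≤ ℓ`, then `S` would be long enough for `k` to force a zero subsequence in it.
  Strict.[ ℕ.≰⇒> (λ k≤ℓ → zeroFree (forces S (ℕ.≤-trans k≤ℓ ℓ≤))) ]
... | _                 | ⊤⁺    | _ = Strict.[ ℓ ]<⊤⁺
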